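{- Let $M=(s_0,S,R,L)$ be a Kripke structure and $\eta$ a CTL formula. If the algorithm $\textsc{Repair}(M,\eta)$ returns a structure $M'=(s_0',S',R',L')$, then (1) $M'$ is total, (2) $M'\subseteq M$, (3) $M',s_0\models\eta$, and (4) $M$ is repairable with respect to $\eta$.
   Context: Let $\mathcal{AP}$ be a set of atomic propositions, including the constants $\mathsf{true}$ and $\mathsf{false}$, which are always interpreted as $\mathit{tt}$ and $\mathit{ff}$ (so $\mathsf{true}\in L(s)$ and $\mathsf{false}\notin L(s)$ for every state $s$). A Kripke structure is a tuple $M=(s_0,S,R,L)$ with $S$ a finite set of states, $s_0\in S$ initial, $R\subseteq S\times S$, $L:S\to2^{\mathcal{AP}}$. It is total if every state has an outgoing transition; the input $M$ is assumed total. Write $s\to t$ for $(s,t)\in R$. A fullpath is an infinite sequence of states consecutive under $R$. Substructure: $M'=(s_0',S',R',L')\subseteq M=(s_0,S,R,L)$ means $S'\subseteq S$, $s_0'=s_0$, $R'\subseteq R$, $L'=L\upharpoonright S'$. $M$ is repairable with respect to $\eta$ if there is a total Kripke structure $M'\subseteq M$ with $M',s_0\models\eta$. CTL: $\varphi ::= \mathsf{true}\mid\mathsf{false}\mid p\mid\neg\varphi\mid\varphi\land\varphi\mid\varphi\lor\varphi\mid \mathsf{AX}\varphi\mid\mathsf{EX}\varphi\mid\mathsf{A}[\varphi\,\mathsf{V}\,\varphi]\mid\mathsf{E}[\varphi\,\mathsf{V}\,\varphi]$, $p\in\mathcal{AP}$. Semantics: $M,s\models p$ iff $p\in L(s)$;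 constants and boolean connectives as usual; $M,s\models\mathsf{AX}\varphi$ (resp. $\mathsf{EX}\varphi$) iff $M,t\models\varphi$ for all (resp. some) $t$ with $s\to t$; $M,s\models\mathsf{A}[\varphi\,\mathsf{V}\,\psi]$ (resp. $\mathsf{E}[\varphi\,\mathsf{V}\,\psi]$) iff for all (resp. some) fullpaths $s=s_0,s_1,\dots$ from $s$: for all $k\ge0$, if $M,s_j\not\models\varphi$ for all $j<k$ then $M,s_k\models\psi$. $\mathit{sub}(\varphi)$: $\mathit{sub}(p)=\{p\}$ for $p$ an atomic proposition, $\mathsf{true}$ or $\mathsf{false}$; $\mathit{sub}(\neg\varphi)=\{\neg\varphi\}\cup\mathit{sub}(\varphi)$; for $\circ\in\{\land,\lor\}$, $\mathit{sub}(\varphi\circ\psi)=\{\varphi\circ\psi\}\cup\mathit{sub}(\varphi)\cup\mathit{sub}(\psi)$; for $Q\in\{\mathsf{A},\mathsf{E}\}$, $\mathit{sub}(Q\mathsf{X}\varphi)=\{Q\mathsf{X}\varphi\}\cup\mathit{sub}(\varphi)$, and with $\rho=Q[\varphi\,\mathsf{V}\,\psi]$, $\mathit{sub}(\rho)=\{\rho,\ Q\mathsf{X}\rho,\ \varphi\lor Q\mathsf{X}\rho,\ \psi\land(\varphi\lor Q\mathsf{X}\rho)\}\cup\mathit{sub}(\varphi)\cup\mathit{sub}(\psi)$. The propositional formula $\mathit{repair}(M,\eta)$ is over propositions $E_{s,t}$ for $(s,t)\in R$; $X_{s,\psi}$ for $s\in S$, $\psi\in\mathit{sub}(\eta)$ (and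 $X_{s,p}$, $p\in\mathcal{AP}$); and $X^m_{s,\psi}$ for $s\in S$, $0\le m\le n=|S|$, and $\psi\in\mathit{sub}(\eta)$ of the form $\mathsf{A}[\varphi\,\mathsf{V}\,\varphi']$ or $\mathsf{E}[\varphi\,\mathsf{V}\,\varphi']$. It is the conjunction, over all $s\in S$ where $s$ is free, of: - $X_{s_0,\eta}$; - $\bigvee_{t\mid s\to t}E_{s,t}$; - $X_{s,p}$ for all $p\in\mathcal{AP}\cap L(s)$, and $\neg X_{s,p}$ for all $p\in\mathcal{AP}-L(s)$; - $X_{s,\neg\varphi}\equiv\neg X_{s,\varphi}$, $X_{s,\varphi\lor\psi}\equiv X_{s,\varphi}\lor X_{s,\psi}$, $X_{s,\varphi\land\psi}\equiv X_{s,\varphi}\land X_{s,\psi}$ for all $\neg\varphi$, $\varphi\lor\psi$, $\varphi\land\psi\in\mathit{sub}(\eta)$ respectively; - $X_{s,\mathsf{AX}\varphi}\equiv\bigwedge_{t\mid s\to t}(E_{s,t}\Rightarrow X_{t,\varphi})$ for all $\mathsf{AX}\varphi\in\mathit{sub}(\eta)$; $X_{s,\mathsf{EX}\varphi}\equiv\bigvee_{t\mid s\to t}(E_{s,t}\land X_{t,\varphi})$ for all $\mathsf{EX}\varphi\in\mathit{sub}(\eta)$; - for all $\rho=\mathsf{A}[\varphi\,\mathsf{V}\,\psi]\in\mathit{sub}(\eta)$: $X_{s,\rho}\equiv X^n_{s,\rho}$; $X^m_{s,\rho}\equiv X_{s,\psi}\land\bigl(X_{s,\varphi}\lor\bigwedge_{t\mid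 s\to t}(E_{s,t}\Rightarrow X^{m-1}_{t,\rho})\bigr)$ for $m\in\{1,\dots,n\}$; $X^0_{s,\rho}\equiv X_{s,\psi}$; - for all $\rho=\mathsf{E}[\varphi\,\mathsf{V}\,\psi]\in\mathit{sub}(\eta)$: $X_{s,\rho}\equiv X^n_{s,\rho}$; $X^m_{s,\rho}\equiv X_{s,\psi}\land\bigl(X_{s,\varphi}\lor\bigvee_{t\mid s\to t}(E_{s,t}\land X^{m-1}_{t,\rho})\bigr)$ for $m\in\{1,\dots,n\}$; $X^0_{s,\rho}\equiv X_{s,\psi}$. For a satisfying assignment $\mathcal{V}$, $\mathit{model}(M,\mathcal{V})=(s_0',S',R',L')$, where $s_0'=s_0$, $R'=\{(s,t)\mid\mathcal{V}(E_{s,t})=\mathit{tt}\}$, $S'$ is the set of all states reachable from $s_0$ via paths of transitions in $R'$ (and $R'$ is regarded as a relation on $S'$), and $L'=L\upharpoonright S'$. Algorithm $\textsc{Repair}(M,\eta)$: model check $M,s_0\models\eta$; if this holds, return $M$. Otherwise compute $\mathit{repair}(M,\eta)$ and submit it to a sound and complete SAT solver. If the solver returns "not satisfiable", return "failure"; otherwise the solver returns a (some, arbitrary) satisfying assignment $\mathcal{V}$, and the algorithm returns $\mathit{model}(M,\mathcal{V})$. -}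

module Defs where

open import Data.Bool using (Bool; true; false; T; not; _∧_; _∨_; _xor_)
open import Data.Bool.Properties using (T?; T-∧; T-≡)
open import Data.Fin using (Fin; zero; suc; fromℕ; inject₁)
open import Data.Fin.Properties using (_≟_)
open import Data.Fin.Subset using (Subset; _∈_; _⊆_; ∣_∣)
open import Data.Fin.Subset.Properties using (_∈?_)
open import Data.List using (List; []; _∷_; [_]; _++_; map; foldr; filterᵇ; allFin)
open import Data.List.Membership.Propositional using () renaming (_∈_ to _∈ˡ_)
open import Data.List.Membership.Propositional.Properties using (∈-allFin)
open import Data.List.Relation.Unary.Any using (here; there)
open import Data.Maybe using (Maybe; just; nothing)
open import Data.Nat using (ℕ; zero; suc; _<_)
open import Data.Product using (∃; _×_; _,_; proj₁; proj₂)
open import Data.Sum using (_⊎_; inj₁; inj₂)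
open import Data.Vec using (tabulate)
open import Data.Vec.Properties using (lookup∘tabulate; []=⇒lookup; lookup⇒[]=)
open import Function using (_∘_)
open import Function.Bundles using (Equivalence)
open import Level using (0ℓ)
open import Relation.Binary.Construct.Closure.ReflexiveTransitive
  using (Star; ε; _◅_; _◅◅_)
open import Relation.Binary.Core using (Rel)
open import Relation.Binary.Definitions using (Decidable)
open import Relation.Binary.PropositionalEquality using (_≡_; refl; sym; trans)
open import Relation.Nullary using (¬_; Dec)
open import Relation.Nullary.Decidable using (⌊_⌋; map′; _⊎-dec_; _×-dec_; toWitness; fromWitness)
open import Relation.Unary using (Pred)

record Atoms : Set₁ where
  field
    AP     : Set
    trueᵃ  : AP
    falseᵃ : AP

open Atoms public

-- State names are drawn from Fin N; the state set S is an arbitrary subset,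
-- so that a structure and its substructures have the same type.  The values
-- of L outside S are irrelevant.
record Kripke (𝒜 : Atoms) (N : ℕ) : Set where
  field
    S       : Subset N
    s₀      : Fin N
    s₀∈S    : s₀ ∈ S
    R       : Fin N → Fin N → Bool
    R⊆S×S   : ∀ {s t} → T (R s t) → s ∈ S × t ∈ S
    L       : Fin N → AP 𝒜 → Bool
    true∈L  : ∀ {s} → s ∈ S → T (L s (trueᵃ 𝒜))
    false∉L : ∀ {s} → s ∈ S → ¬ T (L s (falseᵃ 𝒜))

open Kripke public

infix 4 _⊢_⟶_ _⊑_ _,_⊨_

_⊢_⟶_ : ∀ {𝒜 N} → Kripke 𝒜 N → Fin N → Fin N → Set
M ⊢ s ⟶ t = T (R M s t)

Total : ∀ {𝒜 N} → Kripke 𝒜 N → Set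
Total M = ∀ {s} → s ∈ S M → ∃ λ t → M ⊢ s ⟶ t

record _⊑_ {𝒜 : Atoms} {N : ℕ} (M′ M : Kripke 𝒜 N) : Set where
  field
    S′⊆S   : S M′ ⊆ S M
    s₀′≡s₀ : s₀ M′ ≡ s₀ M
    R′⊆R   : ∀ {s t} → M′ ⊢ s ⟶ t → M ⊢ s ⟶ t
    L′≡L↾S′ : ∀ {s} → s ∈ S M′ → ∀ p → L M′ s p ≡ L M s p

FullPath : ∀ {𝒜 N} → Kripke 𝒜 N → (ℕ → Fin N) → Set
FullPath M π = ∀ i → M ⊢ π i ⟶ π (suc i)

infix  9 ¬ᶜ_
infixr 7 _∧ᶜ_
infixr 6 _∨ᶜ_

-- The constants are the atoms trueᵃ and falseᵃ.
data CTL (𝒜 : Atoms) : Set where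
  atom        : AP 𝒜 → CTL 𝒜
  ¬ᶜ_         : CTL 𝒜 → CTL 𝒜
  _∧ᶜ_ _∨ᶜ_   : CTL 𝒜 → CTL 𝒜 → CTL 𝒜
  AX EX       : CTL 𝒜 → CTL 𝒜
  A[_V_] E[_V_] : CTL 𝒜 → CTL 𝒜 → CTL 𝒜

_,_⊨_ : ∀ {𝒜 N} → Kripke 𝒜 N → Fin N → CTL 𝒜 → Set
M , s ⊨ atom p     = T (L M s p)
M , s ⊨ ¬ᶜ φ       = ¬ (M , s ⊨ φ)
M , s ⊨ φ ∧ᶜ ψ     = (M , s ⊨ φ) × (M , s ⊨ ψ)
M , s ⊨ φ ∨ᶜ ψ     = (M , s ⊨ φ) ⊎ (M , s ⊨ ψ)
M , s ⊨ AX φ       = ∀ t → M ⊢ s ⟶ t → M , t ⊨ φ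
M , s ⊨ EX φ       = ∃ λ t → (M ⊢ s ⟶ t) × (M , t ⊨ φ)
M , s ⊨ A[ φ V ψ ] = ∀ π → FullPath M π → π 0 ≡ s →
  ∀ k → (∀ j → j < k → ¬ (M , π j ⊨ φ)) → M , π k ⊨ ψ
M , s ⊨ E[ φ V ψ ] = ∃ λ π → FullPath M π × π 0 ≡ s ×
  (∀ k → (∀ j → j < k → ¬ (M , π j ⊨ φ)) → M , π k ⊨ ψ)

Repairable : ∀ {𝒜 N} → Kripke 𝒜 N → CTL 𝒜 → Set
Repairable {𝒜} {N} M η =
  ∃ λ (M′ : Kripke 𝒜 N) → Total M′ × M′ ⊑ M × (M′ , s₀ M ⊨ η)

sub : ∀ {𝒜} → CTL 𝒜 → List (CTL 𝒜)
sub (atom p) = [ atom p ]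
sub (¬ᶜ φ)   = ¬ᶜ φ ∷ sub φ
sub (φ ∧ᶜ ψ) = φ ∧ᶜ ψ ∷ sub φ ++ sub ψ
sub (φ ∨ᶜ ψ) = φ ∨ᶜ ψ ∷ sub φ ++ sub ψ
sub (AX φ)   = AX φ ∷ sub φ
sub (EX φ)   = EX φ ∷ sub φ
sub ρ@(A[ φ V ψ ]) =
  ρ ∷ AX ρ ∷ φ ∨ᶜ AX ρ ∷ ψ ∧ᶜ (φ ∨ᶜ AX ρ) ∷ sub φ ++ sub ψ
sub ρ@(E[ φ V ψ ]) =
  ρ ∷ EX ρ ∷ φ ∨ᶜ EX ρ ∷ ψ ∧ᶜ (φ ∨ᶜ EX ρ) ∷ sub φ ++ sub ψ

infix  9 ¬ᵖ_
infixr 7 _∧ᵖ_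
infixr 6 _∨ᵖ_
infixr 5 _⇒ᵖ_
infix  4 _⇔ᵖ_

data Form (Var : Set) : Set where
  var                     : Var → Form Var
  ⊤ᵖ ⊥ᵖ                   : Form Var
  ¬ᵖ_                     : Form Var → Form Var
  _∧ᵖ_ _∨ᵖ_ _⇒ᵖ_ _⇔ᵖ_     : Form Var → Form Var → Form Var

⋀ ⋁ : ∀ {N} {Var : Set} → List (Fin N) → (Fin N → Form Var) → Form Var
⋀ ts f = foldr _∧ᵖ_ ⊤ᵖ (map f ts)
⋁ ts f = foldr _∨ᵖ_ ⊥ᵖ (map f ts)

eval : ∀ {Var} → (Var → Bool) → Form Var → Bool
eval 𝒱 (var x)  = 𝒱 x
eval 𝒱 ⊤ᵖ       = true
eval 𝒱 ⊥ᵖ       = false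
eval 𝒱 (¬ᵖ f)   = not (eval 𝒱 f)
eval 𝒱 (f ∧ᵖ g) = eval 𝒱 f ∧ eval 𝒱 g
eval 𝒱 (f ∨ᵖ g) = eval 𝒱 f ∨ eval 𝒱 g
eval 𝒱 (f ⇒ᵖ g) = not (eval 𝒱 f) ∨ eval 𝒱 g
eval 𝒱 (f ⇔ᵖ g) = not (eval 𝒱 f xor eval 𝒱 g)

-- A conjunction is represented by the set of its conjuncts, because AP may
-- be infinite.
Conjunction : Set → Set₁
Conjunction Var = Pred (Form Var) 0ℓ

Satisfies : ∀ {Var} → (Var → Bool) → Conjunction Var → Set
Satisfies 𝒱 Φ = ∀ {f} → Φ f → T (eval 𝒱 f)

Satisfiable : ∀ {Var} → Conjunction Var → Set
Satisfiable Φ = ∃ λ 𝒱 → Satisfies 𝒱 Φ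

-- The index types are larger than needed; the surplus variables (such as
-- E s t with no transition from s to t in M) do not occur in repair M η.
data RepairVar {𝒜 : Atoms} {N : ℕ} (M : Kripke 𝒜 N) : Set where
  E  : Fin N → Fin N → RepairVar M
  X  : Fin N → CTL 𝒜 → RepairVar M
  X^ : Fin (suc ∣ S M ∣) → Fin N → CTL 𝒜 → RepairVar M

module _ {𝒜 : Atoms} {N : ℕ} (M : Kripke 𝒜 N) where

  private
    n : ℕ
    n = ∣ S M ∣

  post : Fin N → List (Fin N)
  post s = filterᵇ (R M s) (allFin N)

  Eᵛ : Fin N → Fin N → Form (RepairVar M)
  Eᵛ s t = var (E s t)

  Xᵛ : Fin N → CTL 𝒜 → Form (RepairVar M)
  Xᵛ s φ = var (X s φ)

  X^ᵛ : Fin (suc n) → Fin N → CTL 𝒜 → Form (RepairVar M)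
  X^ᵛ m s φ = var (X^ m s φ)

  -- An index m : Fin n in the step conjuncts stands for the step from m to
  -- m + 1.
  data repair (η : CTL 𝒜) : Conjunction (RepairVar M) where
    initial : repair η (Xᵛ (s₀ M) η)
    total   : ∀ {s} → s ∈ S M → repair η (⋁ (post s) λ t → Eᵛ s t)
    label⁺  : ∀ {s p} → s ∈ S M → T (L M s p) → repair η (Xᵛ s (atom p))
    label⁻  : ∀ {s p} → s ∈ S M → ¬ T (L M s p) → repair η (¬ᵖ Xᵛ s (atom p))
    neg     : ∀ {s φ} → s ∈ S M → ¬ᶜ φ ∈ˡ sub η →
              repair η (Xᵛ s (¬ᶜ φ) ⇔ᵖ ¬ᵖ Xᵛ s φ)
    or      : ∀ {s φ ψ} → s ∈ S M → φ ∨ᶜ ψ ∈ˡ sub η →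
              repair η (Xᵛ s (φ ∨ᶜ ψ) ⇔ᵖ Xᵛ s φ ∨ᵖ Xᵛ s ψ)
    and     : ∀ {s φ ψ} → s ∈ S M → φ ∧ᶜ ψ ∈ˡ sub η →
              repair η (Xᵛ s (φ ∧ᶜ ψ) ⇔ᵖ Xᵛ s φ ∧ᵖ Xᵛ s ψ)
    ax      : ∀ {s φ} → s ∈ S M → AX φ ∈ˡ sub η →
              repair η (Xᵛ s (AX φ) ⇔ᵖ ⋀ (post s) λ t → Eᵛ s t ⇒ᵖ Xᵛ t φ)
    ex      : ∀ {s φ} → s ∈ S M → EX φ ∈ˡ sub η →
              repair η (Xᵛ s (EX φ) ⇔ᵖ ⋁ (post s) λ t → Eᵛ s t ∧ᵖ Xᵛ t φ)
    av      : ∀ {s φ ψ} → s ∈ S M → A[ φ V ψ ] ∈ˡ sub η →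
              repair η (Xᵛ s A[ φ V ψ ] ⇔ᵖ X^ᵛ (fromℕ n) s A[ φ V ψ ])
    av-step : ∀ {s φ ψ} → s ∈ S M → A[ φ V ψ ] ∈ˡ sub η → (m : Fin n) →
              repair η (X^ᵛ (suc m) s A[ φ V ψ ] ⇔ᵖ
                Xᵛ s ψ ∧ᵖ (Xᵛ s φ ∨ᵖ
                  ⋀ (post s) λ t → Eᵛ s t ⇒ᵖ X^ᵛ (inject₁ m) t A[ φ V ψ ]))
    av-base : ∀ {s φ ψ} → s ∈ S M → A[ φ V ψ ] ∈ˡ sub η →
              repair η (X^ᵛ zero s A[ φ V ψ ] ⇔ᵖ Xᵛ s ψ)
    ev      : ∀ {s φ ψ} → s ∈ S M → E[ φ V ψ ] ∈ˡ sub η →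
              repair η (Xᵛ s E[ φ V ψ ] ⇔ᵖ X^ᵛ (fromℕ n) s E[ φ V ψ ])
    ev-step : ∀ {s φ ψ} → s ∈ S M → E[ φ V ψ ] ∈ˡ sub η → (m : Fin n) →
              repair η (X^ᵛ (suc m) s E[ φ V ψ ] ⇔ᵖ
                Xᵛ s ψ ∧ᵖ (Xᵛ s φ ∨ᵖ
                  ⋁ (post s) λ t → Eᵛ s t ∧ᵖ X^ᵛ (inject₁ m) t E[ φ V ψ ]))
    ev-base : ∀ {s φ ψ} → s ∈ S M → E[ φ V ψ ] ∈ˡ sub η →
              repair η (X^ᵛ zero s E[ φ V ψ ] ⇔ᵖ Xᵛ s ψ)

module _ {N : ℕ} {_⟶_ : Rel (Fin N) 0ℓ} where

  -- Paths whose intermediate vertices all lie in the given list.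
  Via : List (Fin N) → Rel (Fin N) 0ℓ
  Via []       s t = s ≡ t ⊎ s ⟶ t
  Via (x ∷ xs) s t = Via xs s t ⊎ (Via xs s x × Via xs x t)

  via? : Decidable _⟶_ → ∀ xs → Decidable (Via xs)
  via? _⟶?_ []       s t = (s ≟ t) ⊎-dec (s ⟶? t)
  via? _⟶?_ (x ∷ xs) s t =
    via? _⟶?_ xs s t ⊎-dec (via? _⟶?_ xs s x ×-dec via? _⟶?_ xs x t)

  via⇒star : ∀ xs {s t} → Via xs s t → Star _⟶_ s t
  via⇒star []       (inj₁ refl)    = ε
  via⇒star []       (inj₂ e)       = e ◅ ε
  via⇒star (x ∷ xs) (inj₁ p)       = via⇒star xs p
  via⇒star (x ∷ xs) (inj₂ (p , q)) = via⇒star xs p ◅◅ via⇒star xs q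

  via-base : ∀ xs {s t} → s ≡ t ⊎ s ⟶ t → Via xs s t
  via-base []       p = p
  via-base (x ∷ xs) p = inj₁ (via-base xs p)

  via-trans : ∀ {xs s x t} → x ∈ˡ xs → Via xs s x → Via xs x t → Via xs s t
  via-trans (here refl) (inj₁ p)       (inj₁ q)       = inj₂ (p , q)
  via-trans (here refl) (inj₁ p)       (inj₂ (_ , q)) = inj₂ (p , q)
  via-trans (here refl) (inj₂ (p , _)) (inj₁ q)       = inj₂ (p , q)
  via-trans (here refl) (inj₂ (p , _)) (inj₂ (_ , q)) = inj₂ (p , q)
  via-trans (there x∈)  (inj₁ p)       (inj₁ q)       = inj₁ (via-trans x∈ p q)
  via-trans (there x∈)  (inj₁ p)       (inj₂ (q , r)) = inj₂ (via-trans x∈ p q , r)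
  via-trans (there x∈)  (inj₂ (p , q)) (inj₁ r)       = inj₂ (p , via-trans x∈ q r)
  via-trans (there x∈)  (inj₂ (p , _)) (inj₂ (_ , r)) = inj₂ (p , r)

  star⇒via : ∀ {s t} → Star _⟶_ s t → Via (allFin N) s t
  star⇒via ε       = via-base (allFin N) (inj₁ refl)
  star⇒via (e ◅ p) =
    via-trans (∈-allFin _) (via-base (allFin N) (inj₂ e)) (star⇒via p)

  star? : Decidable _⟶_ → Decidable (Star _⟶_)
  star? _⟶?_ s t = map′ (via⇒star (allFin N)) star⇒via (via? _⟶?_ (allFin N) s t)

module _ {𝒜 : Atoms} {N : ℕ} (M : Kripke 𝒜 N) (𝒱 : RepairVar M → Bool) where

  -- E_{s,t} is a proposition of repair M η only for transitions of M.
  selected : Fin N → Fin N → Bool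
  selected s t = R M s t ∧ 𝒱 (E s t)

  Reachable : Fin N → Set
  Reachable = Star (λ s t → T (selected s t)) (s₀ M)

  reachable? : ∀ t → Dec (Reachable t)
  reachable? = star? (λ s t → T? (selected s t)) (s₀ M)

  reachableStates : Subset N
  reachableStates = tabulate (⌊_⌋ ∘ reachable?)

  ∈⇒reachable : ∀ {t} → t ∈ reachableStates → Reachable t
  ∈⇒reachable {t} t∈ = toWitness {a? = reachable? t}
    (Equivalence.from T-≡
      (trans (sym (lookup∘tabulate (⌊_⌋ ∘ reachable?) t)) ([]=⇒lookup t∈)))

  reachable⇒∈ : ∀ {t} → Reachable t → t ∈ reachableStates
  reachable⇒∈ {t} r = lookup⇒[]= t reachableStates
    (trans (lookup∘tabulate (⌊_⌋ ∘ reachable?) t)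
      (Equivalence.to T-≡ (fromWitness {a? = reachable? t} r)))

  reachable⇒∈S : ∀ {s t} → s ∈ S M → Star (λ s t → T (selected s t)) s t → t ∈ S M
  reachable⇒∈S s∈ ε       = s∈
  reachable⇒∈S s∈ (e ◅ p) =
    reachable⇒∈S (proj₂ (R⊆S×S M (proj₁ (Equivalence.to T-∧ e)))) p

  reachableStates⊆S : reachableStates ⊆ S M
  reachableStates⊆S = reachable⇒∈S (s₀∈S M) ∘ ∈⇒reachable

  model : Kripke 𝒜 N
  model = record
    { S       = reachableStates
    ; s₀      = s₀ M
    ; s₀∈S    = reachable⇒∈ ε
    ; R       = λ s t → ⌊ s ∈? reachableStates ⌋ ∧
                        ⌊ t ∈? reachableStates ⌋ ∧ selected s t
    ; R⊆S×S   = λ {s} {t} e →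
        let (p , q) = Equivalence.to T-∧ e
        in toWitness {a? = s ∈? reachableStates} p ,
           toWitness {a? = t ∈? reachableStates} (proj₁ (Equivalence.to T-∧ q))
    ; L       = L M
    ; true∈L  = true∈L M ∘ reachableStates⊆S
    ; false∉L = false∉L M ∘ reachableStates⊆S
    }

-- Repair is nondeterministic in the satisfying assignment picked by the
-- solver, hence a relation between input and output; nothing is "failure".
-- A sound and complete solver answers "not satisfiable" exactly on the
-- unsatisfiable formulas and otherwise returns some satisfying assignment.
data Repair_,_returns_ {𝒜 : Atoms} {N : ℕ} (M : Kripke 𝒜 N) (η : CTL 𝒜) :
                       Maybe (Kripke 𝒜 N) → Set where
  already-holds : M , s₀ M ⊨ η → Repair M , η returns just M
  unsatisfiable : ¬ (M , s₀ M ⊨ η) → ¬ Satisfiable (repair M η) →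
                  Repair M , η returns nothing
  satisfiable   : ¬ (M , s₀ M ⊨ η) → (𝒱 : RepairVar M → Bool) →
                  Satisfies 𝒱 (repair M η) →
                  Repair M , η returns just (model M 𝒱)

{-# OPTIONS --safe #-}
-- On a total structure, Q[φ V ψ] is the greatest fixpoint of
-- Z ↦ ψ ∧ (φ ∨ QX Z), and the propositions X^0, …, X^n with n = |S| are the
-- descending approximations of that fixpoint.  A descending chain of n steps
-- starting from at most n states either repeats, and is then constant from
-- there on, or loses a state at every step and ends empty; in both cases its
-- last member is the fixpoint.  So X_{s,φ} holds iff φ holds at s in the
-- model, by induction on φ.
module Submission where

open import Defs
open import Data.Bool using (Bool; true; false; T; not; _∨_; _xor_)
open import Data.Bool.Properties using (T?; T-≡; T-∧; T-∨)
open import Data.Empty using (⊥)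
open import Data.Fin using (Fin; zero; suc; toℕ; fromℕ; inject₁)
open import Data.Fin.Induction using (<-weakInduction)
open import Data.Fin.Properties using (toℕ-fromℕ; toℕ-inject₁)
open import Data.Fin.Subset using (Subset; _∈_; _⊆_; ∣_∣; _∩_)
open import Data.Fin.Subset.Properties
  using (_∈?_; p⊆q⇒∣p∣≤∣q∣; p⊂q⇒∣p∣<∣q∣; ∣p∩q∣≤∣p∣; ∩⇔×; x∈p⇒∣p-x∣<∣p∣)
open import Data.List using (List; []; _∷_; allFin)
open import Data.List.Membership.Propositional using () renaming (_∈_ to _∈ˡ_)
open import Data.List.Membership.Propositional.Properties
  using (∈-allFin; ∈-filter⁺; ∈-filter⁻; ∈-++⁺ˡ; ∈-++⁺ʳ)
open import Data.List.Relation.Unary.Any using (here; there)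
open import Data.Maybe using (just)
open import Data.Nat as ℕ using (ℕ; zero; suc; _+_; _≤_; _<_; z<s; s<s)
open import Data.Nat.Properties as ℕ using (module ≤-Reasoning)
open import Data.Product using (∃; _×_; _,_; proj₁; proj₂)
open import Data.Product.Function.NonDependent.Propositional using (_×-⇔_)
open import Data.Sum using (_⊎_; inj₁; inj₂) renaming (map₂ to ⊎-map₂)
open import Data.Sum.Function.Propositional using (_⊎-⇔_)
open import Data.Vec using (tabulate)
open import Data.Vec.Properties using (lookup∘tabulate; []=⇒lookup; lookup⇒[]=)
open import Function using (_∘_; id; _⇔_; mk⇔)
open import Function.Bundles using (module Equivalence)
open import Function.Construct.Composition using (_⇔-∘_)
open import Function.Construct.Identity using (⇔-id)
open import Function.Construct.Symmetry using (⇔-sym)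
open import Function.Related.TypeIsomorphisms using (¬-cong-⇔)
open import Level using (0ℓ)
open import Relation.Binary.Construct.Closure.ReflexiveTransitive using (ε; _◅_; _◅◅_)
open import Relation.Binary.PropositionalEquality using (_≡_; refl; sym; trans; cong; subst)
open import Relation.Nullary using (¬_; Dec; yes; no; contradiction)
open import Relation.Nullary.Decidable using (⌊_⌋; map; decidable-stable; fromWitness)
open import Relation.Unary using (Pred) renaming (_⊆_ to _⊆ᵖ_)

open Equivalence using (to; from)

-- Boolean truth values and finite connectives as propositions.

infixr 1 _⟫_

_⟫_ : {A B C : Set} → A ⇔ B → B ⇔ C → A ⇔ C
f ⟫ g = g ⇔-∘ f

T-not : ∀ {x} → T (not x) ⇔ (¬ T x)
T-not {true}  = mk⇔ (λ ()) (λ ¬t → ¬t _)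
T-not {false} = mk⇔ (λ _ ()) _

T-⇒ : ∀ {x y} → T (not x ∨ y) ⇔ (T x → T y)
T-⇒ {true}  = mk⇔ (λ y _ → y) (λ f → f _)
T-⇒ {false} = mk⇔ (λ _ ()) _

T-xnor : ∀ x y → T (not (x xor y)) → T x ⇔ T y
T-xnor true  true  _ = ⇔-id _
T-xnor false false _ = ⇔-id _

∈-tabulate : ∀ {N} {f : Fin N → Bool} {s} → s ∈ tabulate f ⇔ T (f s)
∈-tabulate {f = f} {s} = mk⇔
  (λ s∈ → from T-≡ (trans (sym (lookup∘tabulate f s)) ([]=⇒lookup s∈)))
  (λ p → lookup⇒[]= s (tabulate f) (trans (lookup∘tabulate f s) (to T-≡ p)))

module _ {Var : Set} (𝒱 : Var → Bool) {N : ℕ} (f : Fin N → Form Var) where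

  eval-⋀ : ∀ ts → T (eval 𝒱 (⋀ ts f)) ⇔ (∀ t → t ∈ˡ ts → T (eval 𝒱 (f t)))
  eval-⋀ []       = mk⇔ (λ _ _ ()) _
  eval-⋀ (t ∷ ts) = T-∧ ⟫ mk⇔
    (λ { (p , _) _ (here refl) → p ; (_ , q) u (there u∈) → to (eval-⋀ ts) q u u∈ })
    (λ h → h t (here refl) , from (eval-⋀ ts) λ u u∈ → h u (there u∈))

  eval-⋁ : ∀ ts → T (eval 𝒱 (⋁ ts f)) ⇔ (∃ λ t → t ∈ˡ ts × T (eval 𝒱 (f t)))
  eval-⋁ []       = mk⇔ (λ ()) (λ { (_ , () , _) })
  eval-⋁ (t ∷ ts) = T-∨ ⟫ mk⇔
    (λ { (inj₁ p) → t , here refl , p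
       ; (inj₂ q) → let (u , u∈ , r) = to (eval-⋁ ts) q in u , there u∈ , r })
    (λ { (_ , here refl , p) → inj₁ p
       ; (u , there u∈ , p) → inj₂ (from (eval-⋁ ts) (u , u∈ , p)) })

-- Finite descending approximation of a greatest fixpoint.

module _ {N n : ℕ} (F : Pred (Fin N) 0ℓ → Pred (Fin N) 0ℓ)
         (mono : ∀ {P Q} → P ⊆ᵖ Q → F P ⊆ᵖ F Q)
         (Z : Fin (suc n) → Subset N)
         (∣Z₀∣≤n : ∣ Z zero ∣ ≤ n)
         (base : ∀ {P} → F P ⊆ᵖ (_∈ Z zero))
         (step : ∀ m {s} → s ∈ Z (suc m) ⇔ F (_∈ Z (inject₁ m)) s)
         where

  approx-descends : ∀ m → F (_∈ Z m) ⊆ᵖ (_∈ Z m)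
  approx-descends = <-weakInduction (λ m → F (_∈ Z m) ⊆ᵖ (_∈ Z m)) base
    λ m ih p → from (step m) (mono (λ q → ih (to (step m) q)) p)

  -- Stability, once reached, is passed on by monotonicity; until then every step removes at least
  -- one element from a set of at most `n`. The bound is stated as a sum to avoid truncated
  -- subtraction.
  approx-stable⊎small : ∀ m → (_∈ Z m) ⊆ᵖ F (_∈ Z m) ⊎ ∣ Z m ∣ + toℕ m ≤ n
  approx-stable⊎small = <-weakInduction _
    (inj₂ (subst (_≤ n) (sym (ℕ.+-identityʳ _)) ∣Z₀∣≤n))
    next-stage
    where
    stays-stable : ∀ m → (_∈ Z (inject₁ m)) ⊆ᵖ (_∈ Z (suc m)) →
                   (_∈ Z (suc m)) ⊆ᵖ F (_∈ Z (suc m))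
    stays-stable m incl p = mono incl (to (step m) p)

    descends : ∀ m → Z (suc m) ⊆ Z (inject₁ m)
    descends m p = approx-descends (inject₁ m) (to (step m) p)

    next-stage : ∀ m →
      (_∈ Z (inject₁ m)) ⊆ᵖ F (_∈ Z (inject₁ m)) ⊎ ∣ Z (inject₁ m) ∣ + toℕ (inject₁ m) ≤ n →
      (_∈ Z (suc m)) ⊆ᵖ F (_∈ Z (suc m)) ⊎ ∣ Z (suc m) ∣ + toℕ (suc m) ≤ n
    next-stage m (inj₁ stable) = inj₁ (stays-stable m λ p → from (step m) (stable p))
    next-stage m (inj₂ small) with ∣ Z (suc m) ∣ ℕ.<? ∣ Z (inject₁ m) ∣
    ... | yes lt = inj₂ (begin
      ∣ Z (suc m) ∣ + suc (toℕ m)          ≡⟨ ℕ.+-suc _ _ ⟩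
      suc ∣ Z (suc m) ∣ + toℕ m            ≤⟨ ℕ.+-monoˡ-≤ (toℕ m) lt ⟩
      ∣ Z (inject₁ m) ∣ + toℕ m            ≡⟨ cong (∣ Z (inject₁ m) ∣ +_) (toℕ-inject₁ m) ⟨
      ∣ Z (inject₁ m) ∣ + toℕ (inject₁ m)  ≤⟨ small ⟩
      n                                    ∎)
      where open ≤-Reasoning
    -- An inclusion of finite sets without a drop in size is not proper, so it reverses.
    ... | no ≮ = inj₁ (stays-stable m λ {x} x∈ →
      decidable-stable (x ∈? Z (suc m)) λ x∉ →
        ≮ (p⊂q⇒∣p∣<∣q∣ (descends m , x , x∈ , x∉)))

  approx-postfix : (_∈ Z (fromℕ n)) ⊆ᵖ F (_∈ Z (fromℕ n))
  approx-postfix with approx-stable⊎small (fromℕ n)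
  ... | inj₁ stable = stable
  -- At index `n` the bound leaves room only for the empty set: a member would give `1 + n ≤ n`.
  ... | inj₂ small = λ s∈ → contradiction
    (ℕ.≤-trans (ℕ.+-monoˡ-≤ n (ℕ.≤-<-trans ℕ.z≤n (x∈p⇒∣p-x∣<∣p∣ s∈)))
      (subst (λ k → ∣ Z (fromℕ n) ∣ + k ≤ n) (toℕ-fromℕ n) small))
    (ℕ.n≮n n)

  -- A post-fixpoint enters the first stage through `base`, and applying `F` carries it from each
  -- stage to the next.
  approx-greatest : ∀ {P} → P ⊆ᵖ F P → ∀ m → P ⊆ᵖ (_∈ Z m)
  approx-greatest {P} post = <-weakInduction (λ m → P ⊆ᵖ (_∈ Z m)) (λ p → base (post p))
    λ m ih p → from (step m) (mono ih (post p))

-- The release operator and its Boolean approximants.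

module _ {𝒜 : Atoms} {N : ℕ} (K : Kripke 𝒜 N) where

  □ ◇ : Pred (Fin N) 0ℓ → Pred (Fin N) 0ℓ
  □ P s = ∀ t → K ⊢ s ⟶ t → P t
  ◇ P s = ∃ λ t → K ⊢ s ⟶ t × P t

  -- The implication is asked for only at states, because transitions end in `S K` and the
  -- equivalences established later hold just there.
  □-map : ∀ {P Q} → (∀ {t} → t ∈ S K → P t → Q t) → □ P ⊆ᵖ □ Q
  □-map h p t e = h (proj₂ (R⊆S×S K e)) (p t e)

  ◇-map : ∀ {P Q} → (∀ {t} → t ∈ S K → P t → Q t) → ◇ P ⊆ᵖ ◇ Q
  ◇-map h (t , e , p) = t , e , h (proj₂ (R⊆S×S K e)) p

  -- One operator serves both path quantifiers, with `O` instantiated to `□` or `◇`. The membership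
  -- conjunct confines its fixpoints to the state set.
  Release : (Pred (Fin N) 0ℓ → Pred (Fin N) 0ℓ) → CTL 𝒜 → CTL 𝒜 →
            Pred (Fin N) 0ℓ → Pred (Fin N) 0ℓ
  Release O φ ψ Z s = s ∈ S K × (K , s ⊨ ψ) × ((K , s ⊨ φ) ⊎ O Z s)

  module _ (O : Pred (Fin N) 0ℓ → Pred (Fin N) 0ℓ)
           (O-map : ∀ {P Q} → (∀ {t} → t ∈ S K → P t → Q t) → O P ⊆ᵖ O Q)
           (φ ψ : CTL 𝒜) {n : ℕ} (∣S∣≤n : ∣ S K ∣ ≤ n)
           (Y : Fin (suc n) → Fin N → Bool)
           (base : ∀ {s} → s ∈ S K → T (Y zero s) ⇔ (K , s ⊨ ψ))
           (step : ∀ m {s} → s ∈ S K →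
             T (Y (suc m) s) ⇔ ((K , s ⊨ ψ) × ((K , s ⊨ φ) ⊎ O (T ∘ Y (inject₁ m)) s)))
           where

    -- `unfold` and `coind` together characterise `G` on states as the greatest fixpoint, which the
    -- last approximant also is. The number of steps `n` is any bound on the number of states, so
    -- that the model can use the size of the structure it was cut from.
    approximants-compute-gfp : (G : Pred (Fin N) 0ℓ) →
      (∀ {s} → s ∈ S K → G s → (K , s ⊨ ψ) × ((K , s ⊨ φ) ⊎ O G s)) →
      (∀ {P} → P ⊆ᵖ Release O φ ψ P → P ⊆ᵖ G) →
      ∀ {s} → s ∈ S K → T (Y (fromℕ n) s) ⇔ G s
    approximants-compute-gfp G unfold coind {s} s∈ = mk⇔
      (λ y → coind (approx-postfix F mono Z ∣Z₀∣≤n base′ step′) (from ∈Z (s∈ , y)))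
      -- `G` is cut down to `S K` to be a post-fixpoint: a universal path formula holds vacuously at
      -- a non-state.
      (λ g → proj₂ (to ∈Z (approx-greatest F mono Z ∣Z₀∣≤n base′ step′ {P = λ t → t ∈ S K × G t}
        (λ { (t∈ , g) → t∈ , proj₁ (unfold t∈ g) ,
               ⊎-map₂ (O-map _,_) (proj₂ (unfold t∈ g)) })
        (fromℕ n) (s∈ , g))))
      where
      F : Pred (Fin N) 0ℓ → Pred (Fin N) 0ℓ
      F = Release O φ ψ

      -- The intersection discards the unconstrained values of `Y` outside `S K` and bounds the size
      -- of every stage.
      Z : Fin (suc n) → Subset N
      Z m = S K ∩ tabulate (Y m)

      ∈Z : ∀ {m t} → t ∈ Z m ⇔ (t ∈ S K × T (Y m t))
      ∈Z = ∩⇔× ⟫ (⇔-id _ ×-⇔ ∈-tabulate)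

      ∣Z₀∣≤n : ∣ Z zero ∣ ≤ n
      ∣Z₀∣≤n = ℕ.≤-trans (∣p∩q∣≤∣p∣ (S K) _) ∣S∣≤n

      mono : ∀ {P Q} → P ⊆ᵖ Q → F P ⊆ᵖ F Q
      mono P⊆Q (t∈ , p , q) = t∈ , p , ⊎-map₂ (O-map λ _ → P⊆Q) q

      base′ : ∀ {P} → F P ⊆ᵖ (_∈ Z zero)
      base′ (t∈ , p , _) = from ∈Z (t∈ , from (base t∈) p)

      step′ : ∀ m {t} → t ∈ Z (suc m) ⇔ F (_∈ Z (inject₁ m)) t
      step′ m = mk⇔
        (λ z → let (t∈ , y) = to ∈Z z
                   (p , q) = to (step m t∈) y
               in t∈ , p , ⊎-map₂ (O-map λ u∈ y′ → from ∈Z (u∈ , y′)) q)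
        (λ { (t∈ , p , q) →
               from ∈Z (t∈ , from (step m t∈)
                 (p , ⊎-map₂ (O-map λ _ z → proj₂ (to ∈Z z)) q)) })

  -- Infinite paths: unfolding and coinduction for the release modalities.

  infixr 5 _▹_

  _▹_ : Fin N → (ℕ → Fin N) → ℕ → Fin N
  (s ▹ π) zero    = s
  (s ▹ π) (suc i) = π i

  ▹-fullPath : ∀ {s π} → K ⊢ s ⟶ π 0 → FullPath K π → FullPath K (s ▹ π)
  ▹-fullPath e full zero    = e
  ▹-fullPath e full (suc i) = full i

  module _ (tot : Total K) where

    module _ (φ ψ : CTL 𝒜) {Z : Pred (Fin N) 0ℓ} (post : Z ⊆ᵖ Release ◇ φ ψ Z) where

      -- A run stays in Z until φ releases it, and then moves arbitrarily.
      Position : Set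
      Position = ∃ λ t → Z t ⊎ t ∈ S K

      anywhere : ∀ {t} → t ∈ S K → ∃ λ (a : Position) → K ⊢ t ⟶ proj₁ a
      anywhere t∈ = let (u , e) = tot t∈ in (u , inj₂ (proj₂ (R⊆S×S K e))) , e

      continue : ∀ {t} → Release ◇ φ ψ Z t → ∃ λ (a : Position) → K ⊢ t ⟶ proj₁ a
      continue (t∈ , _ , inj₁ _)           = anywhere t∈
      continue (_  , _ , inj₂ (u , e , z)) = (u , inj₁ z) , e

      next : (a : Position) → ∃ λ (b : Position) → K ⊢ proj₁ a ⟶ proj₁ b
      next (t , inj₁ z)  = continue (post z)
      next (t , inj₂ t∈) = anywhere t∈

      -- Recursion advances the starting position, so the tail of a run is by definition a run and
      -- inductions can peel off the head.
      run : Position → ℕ → Fin N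
      run a zero    = proj₁ a
      run a (suc i) = run (proj₁ (next a)) i

      run-fullPath : ∀ a → FullPath K (run a)
      run-fullPath a zero    = proj₂ (next a)
      run-fullPath a (suc i) = run-fullPath (proj₁ (next a)) i

      run-releases : ∀ k {t} (z : Z t) → let π = run (t , inj₁ z) in
        (∀ j → j < k → ¬ (K , π j ⊨ φ)) → K , π k ⊨ ψ
      run-releases zero    z unreleased = proj₁ (proj₂ (post z))
      -- The type of the shifted hypothesis contains `next`, which computes only once `post z` is
      -- known; hence both are abstracted together.
      run-releases (suc k) z unreleased with post z | unreleased 0 z<s | (λ j → unreleased (suc j) ∘ s<s)
      ... | _ , _ , inj₁ p            | ¬p | _    = contradiction p ¬p
      ... | _ , _ , inj₂ (_ , _ , z′) | _  | rest = run-releases k z′ rest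

      EV-coind : Z ⊆ᵖ (K ,_⊨ E[ φ V ψ ])
      EV-coind z = run (_ , inj₁ z) , run-fullPath _ , refl , λ k → run-releases k z

    fullPathFrom : ∀ {s} → s ∈ S K → ∃ λ π → FullPath K π × π 0 ≡ s
    -- With the empty post-fixpoint the run only ever moves arbitrarily; `⊤ᶜ` is a placeholder
    -- formula.
    fullPathFrom s∈ = run ⊤ᶜ ⊤ᶜ none (_ , inj₂ s∈) , run-fullPath ⊤ᶜ ⊤ᶜ none _ , refl
      where
      ⊤ᶜ : CTL 𝒜
      ⊤ᶜ = atom (trueᵃ 𝒜)

      none : (λ _ → ⊥) ⊆ᵖ Release ◇ ⊤ᶜ ⊤ᶜ (λ _ → ⊥)
      none ()

    -- Totality provides a path on which to read off `ψ` now. If `φ` fails at `s`, prefixing `s` to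
    -- a path from a successor shifts the universal property by one step; deciding `φ` makes this
    -- case split constructive.
    AV-unfold : ∀ φ ψ {s} → s ∈ S K → Dec (K , s ⊨ φ) → K , s ⊨ A[ φ V ψ ] →
      (K , s ⊨ ψ) × ((K , s ⊨ φ) ⊎ □ (K ,_⊨ A[ φ V ψ ]) s)
    AV-unfold φ ψ {s} s∈ φ? h = now (fullPathFrom s∈) , later φ?
      where
      now : (∃ λ π → FullPath K π × π 0 ≡ s) → K , s ⊨ ψ
      now (π , full , refl) = h π full refl 0 λ _ ()

      later : Dec (K , s ⊨ φ) → (K , s ⊨ φ) ⊎ □ (K ,_⊨ A[ φ V ψ ]) s
      later (yes p) = inj₁ p
      later (no ¬p) = inj₂ λ { t e π full refl k unreleased →
        h (s ▹ π) (▹-fullPath e full) refl (suc k) λ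
          { zero    _         → ¬p
          ; (suc j) (s<s j<k) → unreleased j j<k } }

  EV-unfold : ∀ φ ψ {s} → Dec (K , s ⊨ φ) → K , s ⊨ E[ φ V ψ ] →
    (K , s ⊨ ψ) × ((K , s ⊨ φ) ⊎ ◇ (K ,_⊨ E[ φ V ψ ]) s)
  EV-unfold φ ψ φ? (π , full , refl , h) = h 0 (λ _ ()) , later φ?
    where
    later : Dec (K , π 0 ⊨ φ) → (K , π 0 ⊨ φ) ⊎ ◇ (K ,_⊨ E[ φ V ψ ]) (π 0)
    later (yes p) = inj₁ p
    later (no ¬p) = inj₂ (π 1 , full 0 , π ∘ suc , full ∘ suc , refl ,
      λ k unreleased → h (suc k) λ
        { zero    _         → ¬p
        ; (suc j) (s<s j<k) → unreleased j j<k })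

  -- Every path from `Z` stays in `Z` as long as `φ` has not held, and `Z` implies `ψ`.
  AV-coind : ∀ φ ψ {Z} → Z ⊆ᵖ Release □ φ ψ Z → Z ⊆ᵖ (K ,_⊨ A[ φ V ψ ])
  AV-coind φ ψ {Z} post z π full refl k = along k π full z
    where
    along : ∀ k π → FullPath K π → Z (π 0) →
            (∀ j → j < k → ¬ (K , π j ⊨ φ)) → K , π k ⊨ ψ
    along zero    π full z unreleased = proj₁ (proj₂ (post z))
    along (suc k) π full z unreleased with post z
    ... | _ , _ , inj₁ p = contradiction p (unreleased 0 z<s)
    ... | _ , _ , inj₂ □Z =
      along k (π ∘ suc) (full ∘ suc) (□Z (π 1) (full 0)) λ j → unreleased (suc j) ∘ s<s

-- Substructures and the model of an assignment.

⊑-refl : ∀ {𝒜 N} {M : Kripke 𝒜 N} → M ⊑ M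
⊑-refl = record { S′⊆S = id ; s₀′≡s₀ = refl ; R′⊆R = id ; L′≡L↾S′ = λ _ _ → refl }

module _ {𝒜 : Atoms} {N : ℕ} (M : Kripke 𝒜 N) (𝒱 : RepairVar M → Bool) where

  private
    M′ : Kripke 𝒜 N
    M′ = model M 𝒱

    Holds : Form (RepairVar M) → Set
    Holds f = T (eval 𝒱 f)

  ∈post⇔⟶ : ∀ {s t} → t ∈ˡ post M s ⇔ M ⊢ s ⟶ t
  ∈post⇔⟶ {s} = mk⇔ (proj₂ ∘ ∈-filter⁻ (T? ∘ R M s) {xs = allFin N})
                    (∈-filter⁺ (T? ∘ R M s) (∈-allFin _))

  -- A selected edge out of a reachable state extends its path, so the target passes the
  -- reachability test as well.
  selected⇔⟶ : ∀ {s t} → s ∈ S M′ → T (selected M 𝒱 s t) ⇔ M′ ⊢ s ⟶ t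
  selected⇔⟶ {s} {t} s∈ = mk⇔
    (λ e → from T-∧ (fromWitness {a? = s ∈? S M′} s∈ , from T-∧
      (fromWitness {a? = t ∈? S M′}
        (reachable⇒∈ M 𝒱 (∈⇒reachable M 𝒱 s∈ ◅◅ e ◅ ε)) , e)))
    (λ e → proj₂ (to (T-∧ {x = ⌊ t ∈? S M′ ⌋}) (proj₂ (to (T-∧ {x = ⌊ s ∈? S M′ ⌋}) e))))

  model-edge : ∀ {s t} → s ∈ S M′ →
               (t ∈ˡ post M s × T (𝒱 (E s t))) ⇔ M′ ⊢ s ⟶ t
  model-edge s∈ = (∈post⇔⟶ ×-⇔ ⇔-id _) ⟫ ⇔-sym T-∧ ⟫ selected⇔⟶ s∈

  model-⊑ : M′ ⊑ M
  model-⊑ = record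
    { S′⊆S    = reachableStates⊆S M 𝒱
    ; s₀′≡s₀  = refl
    ; R′⊆R    = λ {s} {t} e →
        proj₁ (to T-∧ (from (selected⇔⟶ {s} {t} (proj₁ (R⊆S×S M′ {s} {t} e))) e))
    ; L′≡L↾S′ = λ _ _ → refl
    }

  eval-□ : ∀ {s} → s ∈ S M′ → (f : Fin N → Form (RepairVar M)) →
    Holds (⋀ (post M s) λ t → Eᵛ M s t ⇒ᵖ f t) ⇔ □ M′ (Holds ∘ f) s
  eval-□ {s} s∈ f = eval-⋀ 𝒱 _ (post M s) ⟫ mk⇔
    (λ h t e → let (t∈ , e′) = from (model-edge s∈) e in to T-⇒ (h t t∈) e′)
    (λ h t t∈ → from T-⇒ λ e → h t (to (model-edge s∈) (t∈ , e)))

  eval-◇ : ∀ {s} → s ∈ S M′ → (f : Fin N → Form (RepairVar M)) →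
    Holds (⋁ (post M s) λ t → Eᵛ M s t ∧ᵖ f t) ⇔ ◇ M′ (Holds ∘ f) s
  eval-◇ {s} s∈ f = eval-⋁ 𝒱 _ (post M s) ⟫ mk⇔
    (λ { (t , t∈ , p) → let (e , q) = to T-∧ p in t , to (model-edge s∈) (t∈ , e) , q })
    (λ { (t , e , p) → let (t∈ , e′) = from (model-edge s∈) e in t , t∈ , from T-∧ (e′ , p) })

  -- Truth of the propositions and satisfaction in the model.

  module _ {η : CTL 𝒜} (sat : Satisfies 𝒱 (repair M η)) where

    model-total : Total M′
    model-total {s} s∈ =
      let (t , t∈ , e) = to (eval-⋁ 𝒱 _ (post M s)) (sat (total (reachableStates⊆S M 𝒱 s∈)))
      in t , to (model-edge s∈) (t∈ , e)

    -- Restricted to states of the model: at unreachable states the propositions still refer to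
    -- selected edges, while the model has no transitions there.
    Correct : CTL 𝒜 → Set
    Correct φ = ∀ {s} → s ∈ S M′ → T (𝒱 (X s φ)) ⇔ (M′ , s ⊨ φ)

    iff : ∀ {f g} → repair M η (f ⇔ᵖ g) → Holds f ⇔ Holds g
    iff {f} {g} c = T-xnor (eval 𝒱 f) (eval 𝒱 g) (sat c)

    -- Satisfaction quantifies over infinite paths; the truth value of `X s φ` nevertheless decides
    -- it.
    correct⇒dec : ∀ φ → Correct φ → ∀ {s} → s ∈ S M′ → Dec (M′ , s ⊨ φ)
    correct⇒dec _ c s∈ = map (c s∈) (T? _)

    ∣S′∣≤n : ∣ S M′ ∣ ≤ ∣ S M ∣
    ∣S′∣≤n = p⊆q⇒∣p∣≤∣q∣ (reachableStates⊆S M 𝒱)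

    -- Structural induction on `φ`; the inclusion of `sub φ` in `sub η` gives access to the
    -- conjuncts of `repair M η` for each subformula.
    subformulas-correct : ∀ φ → (∀ {χ} → χ ∈ˡ sub φ → χ ∈ˡ sub η) → Correct φ
    subformulas-correct (atom p) _ {s} s∈ = mk⇔
      (λ x → decidable-stable (T? (L M s p)) λ ¬l → to T-not (sat (label⁻ (inS s∈) ¬l)) x)
      (λ l → sat (label⁺ (inS s∈) l))
      where inS = reachableStates⊆S M 𝒱
    subformulas-correct (¬ᶜ φ) i s∈ =
      iff (neg (reachableStates⊆S M 𝒱 s∈) (i (here refl))) ⟫ T-not ⟫
      ¬-cong-⇔ (subformulas-correct φ (i ∘ there) s∈)
    subformulas-correct (φ ∧ᶜ ψ) i s∈ =
      iff (and (reachableStates⊆S M 𝒱 s∈) (i (here refl))) ⟫ T-∧ ⟫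
      (subformulas-correct φ (i ∘ there ∘ ∈-++⁺ˡ) s∈ ×-⇔
       subformulas-correct ψ (i ∘ there ∘ ∈-++⁺ʳ (sub φ)) s∈)
    subformulas-correct (φ ∨ᶜ ψ) i s∈ =
      iff (or (reachableStates⊆S M 𝒱 s∈) (i (here refl))) ⟫ T-∨ ⟫
      (subformulas-correct φ (i ∘ there ∘ ∈-++⁺ˡ) s∈ ⊎-⇔
       subformulas-correct ψ (i ∘ there ∘ ∈-++⁺ʳ (sub φ)) s∈)
    subformulas-correct (AX φ) i {s} s∈ =
      iff (ax (reachableStates⊆S M 𝒱 s∈) (i (here refl))) ⟫ eval-□ s∈ (λ t → Xᵛ M t φ) ⟫
      mk⇔ (□-map M′ (to ∘ ih) {s}) (□-map M′ (from ∘ ih) {s})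
      where
      ih : Correct φ
      ih = subformulas-correct φ (i ∘ there)
    subformulas-correct (EX φ) i {s} s∈ =
      iff (ex (reachableStates⊆S M 𝒱 s∈) (i (here refl))) ⟫ eval-◇ s∈ (λ t → Xᵛ M t φ) ⟫
      mk⇔ (◇-map M′ (to ∘ ih) {s}) (◇-map M′ (from ∘ ih) {s})
      where
      ih : Correct φ
      ih = subformulas-correct φ (i ∘ there)
    subformulas-correct ρ@(A[ φ V ψ ]) i s∈ =
      iff (av (inS s∈) ρ∈) ⟫
      approximants-compute-gfp M′ (□ M′) (□-map M′) φ ψ ∣S′∣≤n (λ m s → 𝒱 (X^ m s ρ))
        (λ t∈ → iff (av-base (inS t∈) ρ∈) ⟫ ihψ t∈)
        (λ m t∈ → iff (av-step (inS t∈) ρ∈ m) ⟫ T-∧ ⟫ (ihψ t∈ ×-⇔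
          (T-∨ ⟫ (ihφ t∈ ⊎-⇔ eval-□ t∈ (λ u → X^ᵛ M (inject₁ m) u ρ)))))
        (M′ ,_⊨ ρ)
        (λ t∈ → AV-unfold M′ model-total φ ψ t∈ (correct⇒dec φ ihφ t∈))
        (AV-coind M′ φ ψ)
        s∈
      where
      inS = reachableStates⊆S M 𝒱
      ρ∈ = i (here refl)
      ihφ : Correct φ
      -- The four uses of `there` skip the release formula and its three unfolding formulas at the
      -- head of `sub ρ`.
      ihφ = subformulas-correct φ (i ∘ there ∘ there ∘ there ∘ there ∘ ∈-++⁺ˡ)
      ihψ : Correct ψ
      ihψ = subformulas-correct ψ (i ∘ there ∘ there ∘ there ∘ there ∘ ∈-++⁺ʳ (sub φ))
    subformulas-correct ρ@(E[ φ V ψ ]) i s∈ =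
      iff (ev (inS s∈) ρ∈) ⟫
      approximants-compute-gfp M′ (◇ M′) (◇-map M′) φ ψ ∣S′∣≤n (λ m s → 𝒱 (X^ m s ρ))
        (λ t∈ → iff (ev-base (inS t∈) ρ∈) ⟫ ihψ t∈)
        (λ m t∈ → iff (ev-step (inS t∈) ρ∈ m) ⟫ T-∧ ⟫ (ihψ t∈ ×-⇔
          (T-∨ ⟫ (ihφ t∈ ⊎-⇔ eval-◇ t∈ (λ u → X^ᵛ M (inject₁ m) u ρ)))))
        (M′ ,_⊨ ρ)
        (λ t∈ → EV-unfold M′ φ ψ (correct⇒dec φ ihφ t∈))
        (EV-coind M′ model-total φ ψ)
        s∈
      where
      inS = reachableStates⊆S M 𝒱
      ρ∈ = i (here refl)
      ihφ : Correct φ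
      ihφ = subformulas-correct φ (i ∘ there ∘ there ∘ there ∘ there ∘ ∈-++⁺ˡ)
      ihψ : Correct ψ
      ihψ = subformulas-correct ψ (i ∘ there ∘ there ∘ there ∘ there ∘ ∈-++⁺ʳ (sub φ))

    model-satisfies : M′ , s₀ M ⊨ η
    model-satisfies = to (subformulas-correct η id (s₀∈S M′)) (sat initial)

corollary2 : (𝒜 : Atoms) (N : ℕ) (M : Kripke 𝒜 N) (η : CTL 𝒜) → Total M →
    (M′ : Kripke 𝒜 N) → Repair M , η returns just M′ →
    Total M′ × M′ ⊑ M × (M′ , s₀ M ⊨ η) × Repairable M η
corollary2 𝒜 N M η tot _ (already-holds holds) =
  tot , ⊑-refl , holds , M , tot , ⊑-refl , holds
corollary2 𝒜 N M η _ _ (satisfiable _ 𝒱 sat) =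
  repaired-total , model-⊑ M 𝒱 , repaired-satisfies ,
  model M 𝒱 , repaired-total , model-⊑ M 𝒱 , repaired-satisfies
  where
  repaired-total : Total (model M 𝒱)
  repaired-total = model-total M 𝒱 sat

  repaired-satisfies : model M 𝒱 , s₀ M ⊨ η
  repaired-satisfies = model-satisfies M 𝒱 sat
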